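{- In Version B, the $\mathcal{P}$-positions with exactly $4$ (nonempty) piles are precisely the positions of one of the following forms (the order of the piles is irrelevant): \begin{itemize} \item $1, 1, e_2, e_2$; \item $e_2, e_2, e_2, e_2$; \item $e_2, o_3, o_3, o_3$. \end{itemize}
   Context: Version B is a two-player impartial game. A position consists of finitely many piles of tokens; empty piles are ignored. The players alternate turns; on a turn, a player either removes a single token from any one nonempty pile, or removes one token from each (nonempty) pile. The last player to move wins. A position is a $\mathcal{P}$-position if the player who is not about to move has a winning strategy, equivalently if none of its options (positions reachable in one move) is a $\mathcal{P}$-position; otherwise it is an $\mathcal{N}$-position. A position is written as the list of its pile sizes. Notation: $e_k$ (respectively $o_k$) denotes any even (respectively odd) pile of size at least $k$; different occurrences of the same symbol in a list may stand for different sizes. -}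

module Defs where

open import Data.List using (List; []; _∷_; filter; map)
open import Data.List.Relation.Binary.Permutation.Propositional using (_↭_)
open import Data.List.Relation.Binary.Pointwise using (Pointwise)
open import Data.List.Relation.Unary.Any using (Any)
open import Data.Nat using (ℕ; suc; pred; _≤_; NonZero)
open import Data.Nat.Divisibility using (_∣_; _∤_)
open import Data.Nat.Properties using (nonZero?)
open import Data.Product using (∃-syntax; _×_)
open import Level using (0ℓ)
open import Relation.Unary using (Pred)

-- A list of pile sizes.  A pile reduced to 0 stays in the list; such entries
-- are ignored by the moves and by `piles`.
Position : Set
Position = List ℕ

piles : Position → List ℕ
piles = filter nonZero?

data RemoveOne : Position → Position → Set where
  here  : ∀ {n p}   → RemoveOne (suc n ∷ p) (n ∷ p)
  there : ∀ {n p q} → RemoveOne p q → RemoveOne (n ∷ p) (n ∷ q)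

infix 4 _⟶_

-- `pred 0 = 0`, so `map pred` takes a token from each nonempty pile.  The
-- `Any NonZero` premise excludes the void move from the terminal position.
data _⟶_ (p : Position) : Position → Set where
  one  : ∀ {q} → RemoveOne p q → p ⟶ q
  each : Any NonZero p → p ⟶ map pred p

-- Winning strategies under normal play: an element of 𝒫 p is one for the player
-- who is not about to move, an element of 𝒩 p one for the player about to move.
mutual
  data 𝒫 (p : Position) : Set where
    lose : (∀ {q} → p ⟶ q → 𝒩 q) → 𝒫 p

  data 𝒩 (p : Position) : Set where
    win : ∀ {q} → p ⟶ q → 𝒫 q → 𝒩 p

e o : ℕ → Pred ℕ 0ℓ
e k n = k ≤ n × 2 ∣ n
o k n = k ≤ n × 2 ∤ n

infix 4 _hasForm_

-- Some ordering of the nonempty piles satisfies the given predicates entry by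
-- entry; repeated predicates may be met by different sizes.
_hasForm_ : Position → List (Pred ℕ 0ℓ) → Set₁
p hasForm Ps = ∃[ q ] piles p ↭ q × Pointwise (λ n P → P n) q Ps

{-# OPTIONS --safe #-}
-- The outcome of a position with at most four piles depends only on the numbers
-- of piles equal to 1, even, and odd and at least 3; ten triples are losing.
-- The effect of a move on these numbers is determined once the piles of size 2
-- are counted apart from the larger even ones, so the claim that the losing
-- triples form a kernel is a finite check.
module Submission where

open import Defs
open import Data.List using (List; []; _∷_; length; map; filter; replicate; _++_)
open import Data.List.Properties using (length-replicate; filter-some)
open import Data.List.Relation.Binary.Permutation.Propositional using (_↭_; refl; prep; swap; trans; ↭-sym)
open import Data.List.Relation.Binary.Permutation.Propositional.Properties using (filter-↭; ↭-length; map⁺; shift; ++⁺ˡ)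
open import Data.List.Relation.Binary.Pointwise using (Pointwise; []; _∷_; Pointwise-length)
open import Data.List.Relation.Unary.All as All using (All; all?)
open import Data.List.Relation.Unary.Any using (Any; here; there)
open import Data.Fin using (Fin; zero; suc)
open import Data.Fin.Patterns using (0F; 1F; 2F; 3F; 4F)
import Data.Fin.Properties as Fin
open import Data.Nat using (ℕ; zero; suc; pred; _+_; _≤_; _<_; _≤?_; NonZero; z≤n; s≤s; >-nonZero)
open import Data.Nat.ListAction using (sum)
open import Data.Nat.Divisibility using (_∣_; _∤_; _∣0; ∣-refl; ∣m∣n⇒∣m+n; ∣m+n∣m⇒∣n; ∣1⇒≡1)
open import Data.Nat.Induction using (<-wellFounded)
open import Data.Nat.Properties using (_≟_; nonZero?; allUpTo?; +-suc; +-comm; ≤-refl; ≤-trans; ≤-reflexive; m≤n⇒m≤1+n; m+n≤o⇒m≤o; m+n≤o⇒n≤o; +-mono-≤; +-mono-≤-<; +-monoʳ-<; +-monoʳ-≤; pred[n]≤n)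
open import Data.Product using (∃; ∃₂; ∃-syntax; _×_; _,_)
open import Data.Product.Properties using (≡-dec)
open import Data.Sum using (_⊎_; inj₁; inj₂)
open import Data.Empty using (⊥)
open import Function.Base using (_∘_)
open import Function.Bundles using (_⇔_; mk⇔; Equivalence)
open import Induction.WellFounded using (Acc; acc)
open import Level using (0ℓ)
open import Relation.Binary.PropositionalEquality using (_≡_; refl; sym; cong; cong₂; subst; subst₂) renaming (trans to ≡-trans)
open import Relation.Nullary using (¬_; Dec; yes; no; contradiction)
open import Relation.Nullary.Decidable using (from-yes; _×-dec_; _⊎-dec_; _→-dec_; ¬?)
open import Relation.Unary using (Pred; Decidable)

-- Classes of piles and their counts.

-- A pile is represented by the smallest pile of its class: 3F stands for all
-- odd piles of size at least 3 and 4F for all even piles of size at least 4.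
next : Fin 5 → Fin 5
next 0F = 1F
next 1F = 2F
next 2F = 3F
next 3F = 4F
next 4F = 3F

class : ℕ → Fin 5
class zero    = 0F
class (suc n) = next (class n)

infix 8 #_

#_ : Fin 5 → List (Fin 5) → ℕ
(# c) cs = length (filter (c Fin.≟_) cs)

Triple Quadruple : Set
Triple    = ℕ × ℕ × ℕ
Quadruple = ℕ × ℕ × ℕ × ℕ

-- `4F` precedes `3F` so that `merge` adds adjacent entries; empty piles, of class `0F`, are left
-- out.
counts : List (Fin 5) → Quadruple
counts cs = (# 1F) cs , (# 2F) cs , (# 4F) cs , (# 3F) cs

merge : Quadruple → Triple
merge (i , t , e , o) = i , t + e , o

size : Triple → ℕ
size (i , e , o) = i + (e + o)

counts-↭ : ∀ {cs ds} → cs ↭ ds → counts cs ≡ counts ds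
counts-↭ {cs} {ds} σ = cong₂ _,_ (#-↭ 1F) (cong₂ _,_ (#-↭ 2F) (cong₂ _,_ (#-↭ 4F) (#-↭ 3F)))
  where
  #-↭ : ∀ c → (# c) cs ≡ (# c) ds
  #-↭ c = ↭-length (filter-↭ (c Fin.≟_) σ)

addSingle addEven addOdd : Triple → Triple
addSingle (i , e , o) = suc i , e , o
addEven   (i , e , o) = i , suc e , o
addOdd    (i , e , o) = i , e , suc o

-- A larger even pile enters the right summand of `t + e`, where the successor does not compute. For
-- the other classes the analogous equation holds by definition.
merge-4F : ∀ cs → merge (counts (4F ∷ cs)) ≡ addEven (merge (counts cs))
merge-4F cs = cong (λ e → (# 1F) cs , e , (# 3F) cs) (+-suc ((# 2F) cs) ((# 4F) cs))

profile : Position → Quadruple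
profile p = counts (map class p)

-- Losing triples and the finite check.

_≟₃_ : (x y : Triple) → Dec (x ≡ y)
_≟₃_ = ≡-dec _≟_ (≡-dec _≟_ _≟_)

open import Data.List.Membership.DecPropositional _≟₃_ using (_∈_; _∈?_)

-- Entries: number of piles equal to 1, of even piles, of odd piles of size at least 3.
losing : List Triple
losing = (0 , 0 , 0) ∷ (0 , 1 , 0) ∷ (0 , 2 , 0) ∷ (0 , 1 , 2) ∷ (0 , 3 , 0)
       ∷ (1 , 1 , 1) ∷ (2 , 1 , 0) ∷ (0 , 1 , 3) ∷ (0 , 4 , 0) ∷ (2 , 2 , 0) ∷ []

-- False at 0, as a token can be taken only from a class that has a pile.
AtPred : Pred ℕ 0ℓ → Pred ℕ 0ℓ
AtPred P zero    = ⊥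
AtPred P (suc n) = P n

atPred? : ∀ {P} → Decidable P → Decidable (AtPred P)
atPred? P? zero    = no λ ()
atPred? P? (suc n) = P? n

-- Ones vanish and twos become ones; odd piles turn even and larger even piles odd. Only a triple
-- results, since an odd pile may become a 2 or a larger even pile.
afterEach : Quadruple → Triple
afterEach (i , t , e , o) = t , o , e

-- `Via c x`: from a position with counts x a losing triple is reached by taking
-- a token from one pile of class c or, for c = 0F, from every pile.
Via : Fin 5 → Pred Quadruple 0ℓ
Via 0F x               = NonZero (size (merge x)) × afterEach x ∈ losing
Via 1F (i , t , e , o) = AtPred (λ i′ → (i′ , t + e , o) ∈ losing) i
Via 2F (i , t , e , o) = AtPred (λ t′ → (suc i , t′ + e , o) ∈ losing) t
Via 3F (i , t , e , o) = AtPred (λ o′ → (i , suc (t + e) , o′) ∈ losing) o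
Via 4F (i , t , e , o) = AtPred (λ e′ → (i , t + e′ , suc o) ∈ losing) e

via? : ∀ c → Decidable (Via c)
via? 0F x               = nonZero? _ ×-dec (_ ∈? losing)
via? 1F (i , t , e , o) = atPred? (λ _ → _ ∈? losing) i
via? 2F (i , t , e , o) = atPred? (λ _ → _ ∈? losing) t
via? 3F (i , t , e , o) = atPred? (λ _ → _ ∈? losing) o
via? 4F (i , t , e , o) = atPred? (λ _ → _ ∈? losing) e

Winning : Pred Quadruple 0ℓ
Winning x = ∃ λ c → Via c x

Dichotomy : Pred Quadruple 0ℓ
Dichotomy x = (merge x ∈ losing × ¬ Winning x) ⊎ (¬ merge x ∈ losing × Winning x)

dichotomy? : Decidable Dichotomy
dichotomy? x = (l? ×-dec ¬? w?) ⊎-dec (¬? l? ×-dec w?)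
  where
  l? = merge x ∈? losing
  w? = Fin.any? λ c → via? c x

abstract
  -- A size of at most 4 bounds each entry by 4, so the ranges lose nothing. The evaluated decision
  -- procedure is the proof, and `abstract` keeps it from being unfolded again.
  dichotomy-table : ∀ {i} → i < 5 → ∀ {t} → t < 5 → ∀ {e} → e < 5 → ∀ {o} → o < 5 →
                    size (merge (i , t , e , o)) ≤ 4 → Dichotomy (i , t , e , o)
  dichotomy-table = from-yes
    (allUpTo? (λ i → allUpTo? (λ t → allUpTo? (λ e → allUpTo? (λ o →
      (size (merge (i , t , e , o)) ≤? 4) →-dec dichotomy? (i , t , e , o)) 5) 5) 5) 5)

dichotomy : ∀ x → size (merge x) ≤ 4 → Dichotomy x
dichotomy (i , t , e , o) le = dichotomy-table
  (s≤s (m+n≤o⇒m≤o i le))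
  (s≤s (m+n≤o⇒m≤o t te)) (s≤s (m+n≤o⇒n≤o t te))
  (s≤s (m+n≤o⇒n≤o (t + e) teo)) le
  where
  teo = m+n≤o⇒n≤o i le
  te  = m+n≤o⇒m≤o (t + e) teo

-- Moves in terms of classes.

-- Writing the class before the move as `next d` makes the predecessor in `Via` compute, so both
-- sides agree by definition up to `merge-4F`.
removed⇒via : ∀ d cs → merge (counts (d ∷ cs)) ∈ losing → Via (next d) (counts (next d ∷ cs))
removed⇒via 0F cs l = l
removed⇒via 1F cs l = l
removed⇒via 2F cs l = l
removed⇒via 3F cs l = l
removed⇒via 4F cs l = subst (_∈ losing) (merge-4F cs) l

via⇒removed : ∀ d cs → Via (next d) (counts (next d ∷ cs)) → merge (counts (d ∷ cs)) ∈ losing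
via⇒removed 0F cs l = l
via⇒removed 1F cs l = l
via⇒removed 2F cs l = l
via⇒removed 3F cs l = l
via⇒removed 4F cs l = subst (_∈ losing) (sym (merge-4F cs)) l

atPred⇒nonZero : ∀ {P n} → AtPred P n → NonZero n
atPred⇒nonZero {n = suc n} _ = _

via⇒nonZero : ∀ c cs → Via (suc c) (counts cs) → NonZero ((# suc c) cs)
via⇒nonZero 0F cs = atPred⇒nonZero
via⇒nonZero 1F cs = atPred⇒nonZero
via⇒nonZero 2F cs = atPred⇒nonZero
via⇒nonZero 3F cs = atPred⇒nonZero

-- Indexed by the class after the move, which determines the class before it; the converse fails, as
-- `next 2F` and `next 4F` are both `3F`.
Removes : Position → Position → Fin 5 → Set
Removes p q d = ∃[ cs ] map class p ↭ next d ∷ cs × map class q ↭ d ∷ cs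

removes-there : ∀ {p q d} n → Removes p q d → Removes (n ∷ p) (n ∷ q) d
removes-there {d = d} n (cs , σ , τ) = class n ∷ cs ,
  trans (prep _ σ) (swap _ _ refl) , trans (prep _ τ) (swap _ _ refl)

removeOne⇒removes : ∀ {p q} → RemoveOne p q → ∃[ d ] Removes p q d
removeOne⇒removes (here {n} {p})  = class n , map class p , refl , refl
removeOne⇒removes (there {n} r) with d , m ← removeOne⇒removes r = d , removes-there n m

-- `suc c` rules out `0F`, so the pile found is nonempty. For class `3F` that pile decides whether
-- `d` is `2F` or `4F`.
removable : ∀ c p → NonZero ((# suc c) (map class p)) →
            ∃₂ λ d q → next d ≡ suc c × RemoveOne p q × Removes p q d
removable c (zero  ∷ p) nz with d , q , eq , r , m ← removable c p nz =
  d , zero ∷ q , eq , there r , removes-there zero m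
removable c (suc n ∷ p) nz with suc c Fin.≟ class (suc n)
... | yes eq = class n , n ∷ p , sym eq , here , map class p , refl , refl
... | no _ with d , q , eq , r , m ← removable c p nz =
  d , suc n ∷ q , eq , there r , removes-there (suc n) m

merge-each : ∀ p → merge (profile (map pred p)) ≡ afterEach (profile p)
merge-each []          = refl
merge-each (zero  ∷ p) = merge-each p
merge-each (suc n ∷ p) with class n | merge-each p
... | 0F | ih = ih
... | 1F | ih = cong addSingle ih
... | 2F | ih = cong addEven ih
... | 3F | ih = cong addOdd ih
... | 4F | ih = ≡-trans (merge-4F (map class (map pred p))) (cong addEven ih)

-- Triples and forms.

-- `2F` and `4F` share `e 2` because the forms do not tell 2 from larger even sizes.
Represents : Fin 5 → Pred ℕ 0ℓ
Represents 0F = _≡ 0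
Represents 1F = _≡ 1
Represents 2F = e 2
Represents 3F = o 3
Represents 4F = e 2

2∣n⇒2∤1+n : ∀ {n} → 2 ∣ n → 2 ∤ suc n
2∣n⇒2∤1+n {n} 2∣n 2∣1+n
  with () ← ∣1⇒≡1 (∣m+n∣m⇒∣n (subst (2 ∣_) (+-comm 1 n) 2∣1+n) 2∣n)

2∤n⇒2∣1+n : ∀ n → 2 ∤ n → 2 ∣ suc n
2∤n⇒2∣1+n zero          2∤n = contradiction (2 ∣0) 2∤n
2∤n⇒2∣1+n (suc zero)    2∤n = ∣-refl
2∤n⇒2∣1+n (suc (suc n)) 2∤n = ∣m∣n⇒∣m+n ∣-refl (2∤n⇒2∣1+n n (2∤n ∘ ∣m∣n⇒∣m+n ∣-refl))

represents-next : ∀ c {n} → Represents c n → Represents (next c) (suc n)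
represents-next 0F refl         = refl
represents-next 1F refl         = ≤-refl , ∣-refl
represents-next 2F (2≤n , 2∣n) = s≤s 2≤n , 2∣n⇒2∤1+n 2∣n
represents-next 3F (3≤n , 2∤n) = m≤n⇒m≤1+n (≤-trans (m≤n⇒m≤1+n ≤-refl) 3≤n) , 2∤n⇒2∣1+n _ 2∤n
represents-next 4F (2≤n , 2∣n) = s≤s 2≤n , 2∣n⇒2∤1+n 2∣n

represents-class : ∀ n → Represents (class n) n
represents-class zero    = refl
represents-class (suc n) = represents-next (class n) (represents-class n)

-- With ones first, then even, then odd piles, the three losing triples of size 4 give the lists of
-- the theorem by computation.
form : Triple → List (Pred ℕ 0ℓ)
form (i , e′ , o′) = replicate i (_≡ 1) ++ replicate e′ (e 2) ++ replicate o′ (o 3)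

length-form : ∀ x → length (form x) ≡ size x
length-form (suc i , e′ , o′)        = cong suc (length-form (i , e′ , o′))
length-form (zero , suc e′ , o′)     = cong suc (length-form (zero , e′ , o′))
length-form (zero , zero , o′)       = length-replicate o′

Meets : List ℕ → List (Pred ℕ 0ℓ) → Set₁
Meets = Pointwise λ n P → P n

meets-↭ : ∀ {q Ps Qs} → Meets q Ps → Ps ↭ Qs →
          ∃[ q′ ] q ↭ q′ × Meets q′ Qs
meets-↭ ps refl = _ , refl , ps
meets-↭ (x ∷ ps) (prep _ π) with _ , σ , ps′ ← meets-↭ ps π =
  _ , prep _ σ , x ∷ ps′
meets-↭ (x ∷ y ∷ ps) (swap _ _ π) with _ , σ , ps′ ← meets-↭ ps π =
  _ , swap _ _ σ , y ∷ x ∷ ps′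
meets-↭ ps (trans π ρ) with _ , σ , ps′ ← meets-↭ ps π
                              with _ , τ , ps″ ← meets-↭ ps′ ρ =
  _ , trans σ τ , ps″

hasForm-∷ : ∀ {n} p {P : Pred ℕ 0ℓ} {Ps Qs} → P (suc n) → p hasForm Ps → P ∷ Ps ↭ Qs →
            (suc n ∷ p) hasForm Qs
hasForm-∷ p Pn (q , σ , ps) π with q′ , τ , ps′ ← meets-↭ (Pn ∷ ps) π =
  q′ , trans (prep _ σ) τ , ps′

hasForm-profile : ∀ p → p hasForm form (merge (profile p))
hasForm-profile []          = [] , refl , []
hasForm-profile (zero ∷ p)  = hasForm-profile p
hasForm-profile (suc n ∷ p) with class (suc n) | represents-class (suc n) | hasForm-profile p
... | 1F | r | h = hasForm-∷ p {_≡ 1} r h refl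
... | 2F | r | h = hasForm-∷ p {e 2} r h (↭-sym (shift _ (replicate ((# 1F) (map class p)) _) _))
-- An odd pile belongs behind both the ones and the even piles, hence two shifts.
... | 3F | r | h = hasForm-∷ p {o 3} r h
  (↭-sym (trans (++⁺ˡ ones (shift _ evens _)) (shift _ ones _)))
  where
  ones  = replicate ((# 1F) (map class p)) (_≡ 1)
  evens = replicate ((# 2F) (map class p) + (# 4F) (map class p)) (e 2)
... | 4F | r | h = subst (λ x → (suc n ∷ p) hasForm form x) (sym (merge-4F (map class p)))
  (hasForm-∷ p {e 2} r h (↭-sym (shift _ (replicate ((# 1F) (map class p)) _) _)))

counts-∷ : ∀ c {cs ds} → counts cs ≡ counts ds → counts (c ∷ cs) ≡ counts (c ∷ ds)
counts-∷ 0F eq = eq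
counts-∷ 1F eq = cong (λ (i , t , e , o) → suc i , t , e , o) eq
counts-∷ 2F eq = cong (λ (i , t , e , o) → i , suc t , e , o) eq
counts-∷ 3F eq = cong (λ (i , t , e , o) → i , t , e , suc o) eq
counts-∷ 4F eq = cong (λ (i , t , e , o) → i , t , suc e , o) eq

profile-piles : ∀ p → profile (piles p) ≡ profile p
profile-piles []          = refl
profile-piles (zero ∷ p)  = profile-piles p
profile-piles (suc n ∷ p) = counts-∷ (class (suc n)) (profile-piles p)

-- The predicates `_≡ 1`, `e 2` and `o 3` exclude one another, so each size in `q` is counted in the
-- entry of `x` that its predicate comes from.
meets-form : ∀ x {q} → Meets q (form x) → merge (profile q) ≡ x
meets-form (suc i , e′ , o′) (refl ∷ ps) =
  cong addSingle (meets-form (i , e′ , o′) ps)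
meets-form (zero , suc e′ , o′) (_∷_ {x = n} {xs = q} (2≤n , 2∣n) ps)
  with class n | represents-class n | meets-form (zero , e′ , o′) ps
... | 0F | refl    | _  = contradiction 2≤n λ ()
... | 1F | refl    | _  = contradiction 2≤n λ { (s≤s ()) }
... | 2F | _       | ih = cong addEven ih
... | 3F | _ , 2∤n | _  = contradiction 2∣n 2∤n
... | 4F | _       | ih = ≡-trans (merge-4F (map class q)) (cong addEven ih)
meets-form (zero , zero , suc o′) (_∷_ {x = n} (3≤n , 2∤n) ps)
  with class n | represents-class n | meets-form (zero , zero , o′) ps
... | 0F | refl    | _  = contradiction 3≤n λ ()
... | 1F | refl    | _  = contradiction 3≤n λ { (s≤s ()) }
... | 2F | _ , 2∣n | _  = contradiction 2∣n 2∤n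
... | 3F | _       | ih = cong addOdd ih
... | 4F | _ , 2∣n | _  = contradiction 2∣n 2∤n
meets-form (zero , zero , zero) [] = refl

hasForm⇒profile : ∀ x p → p hasForm form x → merge (profile p) ≡ x
hasForm⇒profile x p (q , σ , ps) = ≡-trans
  (cong merge (≡-trans (sym (profile-piles p)) (counts-↭ (map⁺ class σ))))
  (meets-form x ps)

hasForm⇒length : ∀ p {Ps} → p hasForm Ps → length (piles p) ≡ length Ps
hasForm⇒length p (_ , σ , ps) = ≡-trans (↭-length σ) (Pointwise-length ps)

length-piles : ∀ p → length (piles p) ≡ size (merge (profile p))
length-piles p = ≡-trans (hasForm⇒length p (hasForm-profile p)) (length-form (merge (profile p)))

-- Moves to lost positions.

Lost : Pred Position 0ℓ
Lost p = merge (profile p) ∈ losing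

-- Together with `winning⇒toLost` this carries the finite check over to positions:
-- `Winning (profile p)` holds exactly when some move reaches a `Lost` position.
toLost⇒winning : ∀ {p q} → p ⟶ q → Lost q → Winning (profile p)
toLost⇒winning (one r) l with d , cs , σ , τ ← removeOne⇒removes r = next d ,
  subst (Via (next d)) (sym (counts-↭ σ))
    (removed⇒via d cs (subst (λ x → merge x ∈ losing) (counts-↭ τ) l))
toLost⇒winning {p} (each nz) l = 0F ,
  subst NonZero (length-piles p) (>-nonZero (filter-some nonZero? nz)) ,
  subst (_∈ losing) (merge-each p) l

nonZero⇒any : ∀ p → NonZero (length (piles p)) → Any NonZero p
nonZero⇒any (zero  ∷ p) nz = there (nonZero⇒any p nz)
nonZero⇒any (suc n ∷ p) _  = here _

winning⇒toLost : ∀ p → Winning (profile p) → ∃[ q ] p ⟶ q × Lost q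
winning⇒toLost p (0F , nz , l) =
  map pred p , each (nonZero⇒any p (subst NonZero (sym (length-piles p)) nz)) ,
  subst (_∈ losing) (sym (merge-each p)) l
winning⇒toLost p (suc c , v)
  with d , q , eq , r , cs , σ , τ ← removable c p (via⇒nonZero c (map class p) v) =
  q , one r ,
  subst (λ x → merge x ∈ losing) (sym (counts-↭ τ))
    (via⇒removed d cs (subst₂ Via (sym eq) (counts-↭ σ) v))

-- Numbers of tokens and of piles under a move.

removeOne-sum : ∀ {p q} → RemoveOne p q → sum q < sum p
removeOne-sum here          = ≤-refl
removeOne-sum (there {n} r) = +-monoʳ-< n (removeOne-sum r)

map-pred-sum : ∀ p → sum (map pred p) ≤ sum p
map-pred-sum []      = z≤n
map-pred-sum (n ∷ p) = +-mono-≤ (pred[n]≤n {n}) (map-pred-sum p)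

each-sum : ∀ {p} → Any NonZero p → sum (map pred p) < sum p
each-sum {suc n ∷ p} (here _)   = s≤s (+-monoʳ-≤ n (map-pred-sum p))
each-sum {n ∷ p}     (there nz) = +-mono-≤-< (pred[n]≤n {n}) (each-sum nz)

move-sum : ∀ {p q} → p ⟶ q → sum q < sum p
move-sum (one r)   = removeOne-sum r
move-sum (each nz) = each-sum nz

removeOne-piles : ∀ {p q} → RemoveOne p q → length (piles q) ≤ length (piles p)
removeOne-piles (here {zero})      = m≤n⇒m≤1+n ≤-refl
removeOne-piles (here {suc n})     = ≤-refl
removeOne-piles (there {zero}  r)  = removeOne-piles r
removeOne-piles (there {suc n} r)  = s≤s (removeOne-piles r)

map-pred-piles : ∀ p → length (piles (map pred p)) ≤ length (piles p)
map-pred-piles []                = z≤n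
map-pred-piles (zero ∷ p)        = map-pred-piles p
map-pred-piles (suc zero ∷ p)    = m≤n⇒m≤1+n (map-pred-piles p)
map-pred-piles (suc (suc n) ∷ p) = s≤s (map-pred-piles p)

-- Keeps every option within the bound of four piles under which `dichotomy` applies.
move-piles : ∀ {p q} → p ⟶ q → length (piles q) ≤ length (piles p)
move-piles (one r)      = removeOne-piles r
move-piles {p} (each _) = map-pred-piles p

-- Outcomes with at most four piles.

-- Induction on the number of tokens. No option of a `Lost` position is `Lost`, so all are in `𝒩`;
-- from any other position the check supplies a move to a `Lost` one, which is in `𝒫`.
outcome : ∀ p → Acc _<_ (sum p) → length (piles p) ≤ 4 → (Lost p × 𝒫 p) ⊎ (¬ Lost p × 𝒩 p)
outcome p (acc rs) le with dichotomy (profile p) (subst (_≤ 4) (length-piles p) le)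
... | inj₁ (l , ¬w) = inj₁ (l , lose reply)
  where
  reply : ∀ {q} → p ⟶ q → 𝒩 q
  reply {q} m with outcome q (rs (move-sum m)) (≤-trans (move-piles m) le)
  ... | inj₁ (lq , _) = contradiction (toLost⇒winning m lq) ¬w
  ... | inj₂ (_ , nq) = nq
... | inj₂ (¬l , w) with q , m , lq ← winning⇒toLost p w
  with outcome q (rs (move-sum m)) (≤-trans (move-piles m) le)
... | inj₁ (_ , pq)  = inj₂ (¬l , win m pq)
... | inj₂ (¬lq , _) = contradiction lq ¬lq

-- The two strategies are played against each other: after the move of `win` they exchange roles,
-- and both have become structurally smaller.
𝒫⇒¬𝒩 : ∀ {p} → 𝒫 p → ¬ 𝒩 p
𝒫⇒¬𝒩 (lose f) (win m q) = 𝒫⇒¬𝒩 q (f m)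

𝒫⇔Lost : ∀ p → length (piles p) ≤ 4 → 𝒫 p ⇔ Lost p
𝒫⇔Lost p le with outcome p (<-wellFounded _) le
... | inj₁ (l , pp)  = mk⇔ (λ _ → l) (λ _ → pp)
... | inj₂ (¬l , np) = mk⇔ (λ pp → contradiction np (𝒫⇒¬𝒩 pp)) (λ l → contradiction l ¬l)

-- Exactly four piles.

losing₄ : ∀ {x} → x ∈ losing → size x ≡ 4 → x ≡ (2 , 2 , 0) ⊎ x ≡ (0 , 4 , 0) ⊎ x ≡ (0 , 1 , 3)
losing₄ l eq = All.lookup table l eq
  where
  table : All (λ x → size x ≡ 4 → x ≡ (2 , 2 , 0) ⊎ x ≡ (0 , 4 , 0) ⊎ x ≡ (0 , 1 , 3)) losing
  table = from-yes (all? (λ x → (size x ≟ 4) →-dec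
    ((x ≟₃ (2 , 2 , 0)) ⊎-dec ((x ≟₃ (0 , 4 , 0)) ⊎-dec (x ≟₃ (0 , 1 , 3))))) losing)

lemma2p4 : (p : Position) →
    (length (piles p) ≡ 4 × 𝒫 p) ⇔
    ( p hasForm ((_≡ 1) ∷ (_≡ 1) ∷ e 2 ∷ e 2 ∷ [])
    ⊎ p hasForm (e 2 ∷ e 2 ∷ e 2 ∷ e 2 ∷ [])
    ⊎ p hasForm (e 2 ∷ o 3 ∷ o 3 ∷ o 3 ∷ []) )
lemma2p4 p = mk⇔ to from
  where
  has : ∀ {x} → merge (profile p) ≡ x → p hasForm form x
  has eq = subst (λ x → p hasForm form x) eq (hasForm-profile p)

  to : _ → _
  to (four , pp) with losing₄ (Equivalence.to (𝒫⇔Lost p (≤-reflexive four)) pp)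
                              (≡-trans (sym (length-piles p)) four)
  ... | inj₁ eq        = inj₁ (has eq)
  ... | inj₂ (inj₁ eq) = inj₂ (inj₁ (has eq))
  ... | inj₂ (inj₂ eq) = inj₂ (inj₂ (has eq))

  lost : ∀ x → x ∈ losing → size x ≡ 4 → p hasForm form x → length (piles p) ≡ 4 × 𝒫 p
  -- The form fixes the number of piles, which gives the bound for `𝒫⇔Lost`.
  lost x l four h = len ,
    Equivalence.from (𝒫⇔Lost p (≤-reflexive len)) (subst (_∈ losing) (sym (hasForm⇒profile x p h)) l)
    where
    len = ≡-trans (hasForm⇒length p h) (≡-trans (length-form x) four)

  from : _ → _
  from (inj₁ h)        = lost (2 , 2 , 0) (from-yes ((2 , 2 , 0) ∈? losing)) refl h
  from (inj₂ (inj₁ h)) = lost (0 , 4 , 0) (from-yes ((0 , 4 , 0) ∈? losing)) refl h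
  from (inj₂ (inj₂ h)) = lost (0 , 1 , 3) (from-yes ((0 , 1 , 3) ∈? losing)) refl h
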